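{- Let $q,\alpha_2\in\mathbb{Q}$ with $q\notin[0,5]$ and $\alpha_2\in(-2,0)$. Given a positive constant $\rho$ which is sufficiently small with respect to $q$ and $\alpha_2$, there is a planar graph $\Upsilon$ (depending on $\rho$) and a weight function $\widehat w:E(\Upsilon)\to\{\alpha_2\}$ that implements a weight $\beta$ such that $|1+\beta|\le\rho$. The size of $\Upsilon$ is at most a polynomial in $\log(\rho^{ -1})$.
   Context: Graphs are finite and may have loops and multiple edges. The number $q$ is fixed. A planar graph $\Upsilon$ with distinct distinguished vertices $s,t$ on the outer face and weights $\widehat w:E(\Upsilon)\to\mathbb{Q}$ implements the weight $w^*$ if $Z_{s|t}(\Upsilon)\ne0$ and $w^*=qZ_{st}(\Upsilon)/Z_{s|t}(\Upsilon)$. Here $Z_{st}(\Upsilon)$ (resp. $Z_{s|t}(\Upsilon)$) is the sum of $\big(\prod_{e\in A}\widehat w(e)\big)q^{\kappa(V(\Upsilon),A)}$ over all $A\subseteq E(\Upsilon)$ such that $s,t$ are in the same component (resp. different components) of $(V(\Upsilon),A)$, and $\kappa(V(\Upsilon),A)$ is the number of connected components of $(V(\Upsilon),A)$. The size bound means that the polynomial may depend on $q,\alpha_2$ but not on $\rho$. -}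

module Defs where

open import Data.Bool.Base using (Bool; true; false; not; if_then_else_)
open import Data.Fin.Base using (Fin; zero; suc; _≤_)
open import Data.Fin.Properties using (_≟_; _≤?_; all?)
open import Data.Fin.Subset using (Subset; inside; outside; ⊤; _∈_)
open import Data.Fin.Subset.Properties using (_∈?_)
import Data.Integer.Base as ℤ
open import Data.List.Base as List using (List; []; _∷_; _++_; allFin; filter; foldr; length)
open import Data.Nat.Base as ℕ using (ℕ; zero; suc)
open import Data.Nat.Logarithm using (⌈log₂_⌉)
open import Data.Product.Base using (Σ; ∃; ∃₂; _×_; _,_; proj₁; proj₂)
open import Data.Rational.Base
  using (ℚ; 0ℚ; 1ℚ; _+_; _*_; _÷_; 1/_; ceiling; Positive; ≢-nonZero; +-*-rawSemiring)
open import Data.Rational.Properties using (pos⇒nonZero)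
open import Data.Sum.Base using (_⊎_; inj₁; inj₂)
open import Data.Vec.Base as Vec using (here; there)
open import Function.Base using (_∘_)
open import Function.Bundles using (_⇔_; _↔_; Inverse)
open import Relation.Binary.Construct.Closure.Equivalence as EqC using (EqClosure)
open import Relation.Binary.Construct.Closure.ReflexiveTransitive using (ε; _◅_)
open import Relation.Binary.Construct.Closure.Symmetric using (fwd; bwd)
open import Relation.Binary.Core using (Rel)
open import Relation.Binary.Definitions using (Decidable)
open import Relation.Binary.PropositionalEquality
  using (_≡_; _≢_; refl; setoid)
open import Relation.Nullary using (does; ¬_; ¬?; _×-dec_; _⊎-dec_; _→-dec_; map′)
open import Relation.Unary using () renaming (Decidable to Decidable₁)

open import Algebra.Definitions.RawSemiring +-*-rawSemiring public
  using (_^_; product)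

-- Each edge is stored with an ordered pair of ends; the order carries no
-- meaning.  Loops and parallel edges are allowed.
record Graph : Set where
  field
    #V #E : ℕ
    ends  : Fin #E → Fin #V × Fin #V

-- Connectivity in a spanning subgraph

module _ {n m : ℕ} (ends : Fin m → Fin n × Fin n) where

  Link : Subset m → Rel (Fin n) _
  Link A u v = ∃ λ e → e ∈ A × ends e ≡ (u , v)

  Connected : Subset m → Rel (Fin n) _
  Connected A = EqClosure (Link A)

module _ {n m : ℕ} (ends : Fin (suc m) → Fin n × Fin n) (A : Subset m) where

  private
    a b : Fin n
    a = proj₁ (ends zero)
    b = proj₂ (ends zero)

    _~_ : Rel (Fin n) _
    _~_ = Connected (ends ∘ suc) A

    trans~ : ∀ {u v w} → u ~ v → v ~ w → u ~ w
    trans~ = EqC.transitive (Link (ends ∘ suc) A)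

    sym~ : ∀ {u v} → u ~ v → v ~ u
    sym~ = EqC.symmetric (Link (ends ∘ suc) A)

    Joined : Rel (Fin n) _
    Joined u v = u ~ v ⊎ (u ~ a × b ~ v) ⊎ (u ~ b × a ~ v)

    pre : ∀ {u v w} → u ~ v → Joined v w → Joined u w
    pre p (inj₁ q)              = inj₁ (trans~ p q)
    pre p (inj₂ (inj₁ (q , r))) = inj₂ (inj₁ (trans~ p q , r))
    pre p (inj₂ (inj₂ (q , r))) = inj₂ (inj₂ (trans~ p q , r))

    pre-ab : ∀ {w} → Joined b w → Joined a w
    pre-ab (inj₁ q)              = inj₂ (inj₁ (ε , q))
    pre-ab (inj₂ (inj₁ (q , r))) = inj₂ (inj₁ (ε , r))
    pre-ab (inj₂ (inj₂ (q , r))) = inj₁ r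

    pre-ba : ∀ {w} → Joined a w → Joined b w
    pre-ba (inj₁ q)              = inj₂ (inj₂ (ε , q))
    pre-ba (inj₂ (inj₁ (q , r))) = inj₁ r
    pre-ba (inj₂ (inj₂ (q , r))) = inj₂ (inj₂ (ε , r))

  lift : ∀ {x u v} → Connected (ends ∘ suc) A u v → Connected ends (x Vec.∷ A) u v
  lift = EqC.map λ { (e , e∈A , eq) → suc e , there e∈A , eq }

  lower : ∀ {u v} → Connected ends (outside Vec.∷ A) u v → Connected (ends ∘ suc) A u v
  lower = EqC.map λ { (suc e , there e∈A , eq) → e , e∈A , eq }

  split : ∀ {u v} → Connected ends (inside Vec.∷ A) u v → Joined u v
  split ε = inj₁ ε
  split (fwd (zero  , _         , refl) ◅ p) = pre-ab (split p)
  split (bwd (zero  , _         , refl) ◅ p) = pre-ba (split p)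
  split (fwd (suc e , there e∈A , eq) ◅ p) = pre (EqC.return (e , e∈A , eq)) (split p)
  split (bwd (suc e , there e∈A , eq) ◅ p) = pre (sym~ (EqC.return (e , e∈A , eq))) (split p)

  unsplit : ∀ {u v} → Joined u v → Connected ends (inside Vec.∷ A) u v
  unsplit = λ where
      (inj₁ p)              → lift p
      (inj₂ (inj₁ (p , q))) → trans′ (lift p) (trans′ ab (lift q))
      (inj₂ (inj₂ (p , q))) → trans′ (lift p) (trans′ (sym′ ab) (lift q))
    where
    R      = Link ends (inside Vec.∷ A)
    trans′ : ∀ {u v w} → EqClosure R u v → EqClosure R v w → EqClosure R u w
    trans′ = EqC.transitive R
    sym′ : ∀ {u v} → EqClosure R u v → EqClosure R v u
    sym′   = EqC.symmetric R
    ab : EqClosure R a b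
    ab     = EqC.return (zero , here , refl)

  joined? : Decidable _~_ → Decidable Joined
  joined? c? u v =
    c? u v ⊎-dec ((c? u a ×-dec c? b v) ⊎-dec (c? u b ×-dec c? a v))

connected? : ∀ {n m} (ends : Fin m → Fin n × Fin n) (A : Subset m) →
             Decidable (Connected ends A)
connected? ends Vec.[] u v = map′ (λ { refl → ε }) empty (u ≟ v)
  where
  empty : ∀ {u v} → Connected ends Vec.[] u v → u ≡ v
  empty ε                  = refl
  empty (fwd (() , _) ◅ _)
  empty (bwd (() , _) ◅ _)
connected? ends (outside Vec.∷ A) u v =
  map′ (lift ends A) (lower ends A) (connected? (ends ∘ suc) A u v)
connected? ends (inside Vec.∷ A) u v =
  map′ (unsplit ends A) (split ends A)
       (joined? ends A (connected? (ends ∘ suc) A) u v)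

module _ (G : Graph) where
  open Graph G

  -- Components are counted by their least vertices.
  LeastInComponent : Subset #E → Fin #V → Set
  LeastInComponent A v = ∀ u → Connected ends A u v → v ≤ u

  leastInComponent? : ∀ A → Decidable₁ (LeastInComponent A)
  leastInComponent? A v = all? λ u → connected? ends A u v →-dec v ≤? u

  κ : Subset #E → ℕ
  κ A = length (filter (leastInComponent? A) (allFin #V))

  Isolated : Fin #V → Set
  Isolated v = ∀ e → proj₁ (ends e) ≢ v × proj₂ (ends e) ≢ v

  isolated? : Decidable₁ Isolated
  isolated? v = all? λ e → ¬? (proj₁ (ends e) ≟ v) ×-dec ¬? (proj₂ (ends e) ≟ v)

  #isolated : ℕ
  #isolated = length (filter isolated? (allFin #V))

  -- A dart is an edge with a direction of traversal.
  Dart : Set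
  Dart = Fin #E × Bool

  tail : Dart → Fin #V
  tail (e , false) = proj₁ (ends e)
  tail (e , true)  = proj₂ (ends e)

  reverse : Dart → Dart
  reverse (e , b) = e , not b

  SameOrbit : (Dart → Dart) → Rel Dart _
  SameOrbit f = EqClosure λ d d′ → f d ≡ d′

  -- Embeddings in the sphere are given by rotation systems: `rotation` lists
  -- the darts leaving each vertex in cyclic order, and the facial walks are the
  -- orbits of `next`.  A component with an edge has Euler characteristic at most
  -- 2 with respect to its facial walks, with equality iff its embedding is
  -- spherical; an isolated vertex contributes one vertex and one (empty) facial
  -- walk, hence exactly 2.  Summing over components, `euler` says that every
  -- component is embedded in the sphere.
  record PlanarEmbedding : Set where
    field
      rotation : Dart ↔ Dart

    next : Dart → Dart
    next d = Inverse.to rotation (reverse d)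

    field
      rotation-orbits : ∀ d d′ →
        tail d ≡ tail d′ ⇔ SameOrbit (Inverse.to rotation) d d′
      #walks : ℕ
      walks  : Inverse (EqC.setoid λ d d′ → next d ≡ d′) (setoid (Fin #walks))
      euler  : #V ℕ.+ (#walks ℕ.+ #isolated) ≡ #E ℕ.+ 2 ℕ.* κ ⊤

    -- Any facial walk of a spherical component can be made to bound the outer
    -- face, and this can be done independently in different components.
    OnOuterFace : Fin #V → Fin #V → Set
    OnOuterFace s t =
      (∃₂ λ d d′ → tail d ≡ s × tail d′ ≡ t × SameOrbit next d d′)
      ⊎ ¬ Connected ends ⊤ s t

record PlanarTwoTerminalGraph : Set where
  field
    graph     : Graph
  open Graph graph public
  field
    s t       : Fin #V
    s≢t       : s ≢ t
    embedding : PlanarEmbedding graph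
    outer     : PlanarEmbedding.OnOuterFace embedding s t

subsets : ∀ m → List (Subset m)
subsets zero    = Vec.[] ∷ []
subsets (suc m) =
  List.map (outside Vec.∷_) (subsets m) ++ List.map (inside Vec.∷_) (subsets m)

sumℚ : List ℚ → ℚ
sumℚ = foldr _+_ 0ℚ

module _ (q : ℚ) (Υ : PlanarTwoTerminalGraph) where
  open PlanarTwoTerminalGraph Υ

  term : (Fin #E → ℚ) → Subset #E → ℚ
  term ŵ A = product (λ e → if does (e ∈? A) then ŵ e else 1ℚ)
             * q ^ κ graph A

  Zₛₜ : (Fin #E → ℚ) → ℚ
  Zₛₜ ŵ = sumℚ (List.map (term ŵ)
    (filter (λ A → connected? ends A s t) (subsets #E)))

  Zₛ|ₜ : (Fin #E → ℚ) → ℚ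
  Zₛ|ₜ ŵ = sumℚ (List.map (term ŵ)
    (filter (λ A → ¬? (connected? ends A s t)) (subsets #E)))

  Implements : (Fin #E → ℚ) → ℚ → Set
  Implements ŵ w* =
    Σ (Zₛ|ₜ ŵ ≢ 0ℚ) λ Z≢0 →
      w* ≡ ((q * Zₛₜ ŵ) ÷ Zₛ|ₜ ŵ) {{≢-nonZero Z≢0}}

size : PlanarTwoTerminalGraph → ℕ
size Υ = #V ℕ.+ #E
  where open PlanarTwoTerminalGraph Υ

-- Coefficients in order of increasing degree.
Polynomial : Set
Polynomial = List ℕ

eval : Polynomial → ℕ → ℕ
eval p x = foldr (λ c r → c ℕ.+ x ℕ.* r) 0 p

-- For ρ ≤ 1 this is the ceiling of the real number log₂ (ρ⁻¹), because
-- x ≤ 2ᵏ iff ⌈x⌉ ≤ 2ᵏ.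
⌈log₂_⁻¹⌉ : (ρ : ℚ) → .{{Positive ρ}} → ℕ
⌈log₂ ρ ⁻¹⌉ = ⌈log₂ ℤ.∣ ceiling ((1/ ρ) {{pos⇒nonZero ρ}}) ∣ ⌉

-- Parallel composition multiplies the quantities 1 + w, so k parallel edges of
-- weight α₂ implement (1 + α₂)ᵏ − 1, provided that q ≠ 0.  Since ∣ 1 + α₂ ∣ < 1,
-- some fixed power N of it is at most 1/2, and k > N ⌈log₂ ρ⁻¹⌉ edges suffice.
module Submission where

open import Defs
open import Data.Integer.Base using (+_; -[1+_])
open import Data.Nat.Base as ℕ using ()
open import Data.Product.Base using (Σ-syntax; _×_)
open import Data.Rational.Base using (ℚ; 0ℚ; 1ℚ; _/_; _+_; _≤_; _<_; ∣_∣; Positive)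
open import Data.Fin.Base using (Fin)
open import Relation.Binary.PropositionalEquality using (_≡_)
open import Relation.Nullary using (¬_)

open import Algebra.Bundles using (CommutativeRing)
open import Data.Bool.Base using (true; false; if_then_else_)
open import Data.Fin.Base as Fin using (zero; suc; inject₁)
open import Data.Fin.Induction using (<-weakInduction)
open import Data.Fin.Relation.Unary.Top using (view; ‵fromℕ; ‵inject₁; view-fromℕ; view-inject₁)
open import Data.Fin.Subset using (Subset; Nonempty; inside; outside; ⊤; ⊥)
open import Data.Fin.Subset.Properties using (_∈?_; ∉⊥; ∈⊤)
import Data.Integer.Base as ℤ
import Data.Integer.DivMod as ℤ
import Data.Integer.Properties as ℤ
open import Data.List.Base as List using (List; []; _∷_; _++_; filter)
open import Data.List.Properties using (filter-accept; filter-reject; filter-all; filter-none; map-++; map-∘)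
open import Data.List.Relation.Unary.All as All using (All; []; _∷_)
open import Data.List.Relation.Unary.All.Properties using (++⁺; map⁺)
open import Data.Nat.Base using (ℕ; zero; suc)
open import Data.Nat.Induction using (<-wellFounded)
open import Data.Nat.Logarithm using (⌈log₂_⌉)
open import Data.Nat.Logarithm.Core using (⌈log2⌉)
import Data.Nat.Properties as ℕ
open import Data.Product.Base as Product using (∃; _,_; proj₁; proj₂)
open import Data.Rational.Base
  using (*≤*; NonNegative; ↥_; ↧_; floor; ceiling; positive; ≢-nonZero; 1/_; -_; _-_; _*_)
open import Data.Rational.Literals using (fromℤ)
open import Data.Rational.Properties
open import Data.Rational.Solver using (module +-*-Solver)
open import Data.Sum.Base using (inj₁; inj₂)
import Data.Vec.Base as Vec
open import Function.Base using (_∘_; const; it)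
open import Function.Bundles using (_↔_; mk↔ₛ′; mk⇔)
open import Induction.WellFounded using (Acc; acc)
open import Relation.Binary.Construct.Closure.Equivalence as EqC using ()
open import Relation.Binary.Construct.Closure.ReflexiveTransitive using (ε)
open import Relation.Binary.PropositionalEquality
  using (_≢_; refl; sym; trans; cong; cong₂; subst; isEquivalence; module ≡-Reasoning)
open import Relation.Nullary using (does; ¬?; contradiction)

open import Algebra.Properties.Semiring.Exp (CommutativeRing.semiring +-*-commutativeRing)
  using (^-assocʳ)
open import Algebra.Properties.CommutativeSemiring.Exp (CommutativeRing.commutativeSemiring +-*-commutativeRing)
  using (^-distrib-*)

n≤2^⌈log2⌉n : ∀ n (rs : Acc ℕ._<_ n) → n ℕ.≤ 2 ℕ.^ ⌈log2⌉ n rs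
n≤2^⌈log2⌉n 0             _        = ℕ.z≤n
n≤2^⌈log2⌉n 1             _        = ℕ.≤-refl
n≤2^⌈log2⌉n (suc (suc n)) (acc rs) = begin
  2 ℕ.+ n                              ≡⟨ cong (2 ℕ.+_) (ℕ.⌊n/2⌋+⌈n/2⌉≡n n) ⟨
  2 ℕ.+ (ℕ.⌊ n /2⌋ ℕ.+ ℕ.⌈ n /2⌉)      ≤⟨ ℕ.+-monoʳ-≤ 2 (ℕ.+-monoˡ-≤ ℕ.⌈ n /2⌉ (ℕ.⌊n/2⌋≤⌈n/2⌉ n)) ⟩
  2 ℕ.+ (ℕ.⌈ n /2⌉ ℕ.+ ℕ.⌈ n /2⌉)      ≡⟨ cong (λ x → 2 ℕ.+ (ℕ.⌈ n /2⌉ ℕ.+ x)) (ℕ.+-identityʳ _) ⟨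
  2 ℕ.+ 2 ℕ.* ℕ.⌈ n /2⌉                ≡⟨ ℕ.*-suc 2 ℕ.⌈ n /2⌉ ⟨
  2 ℕ.* suc ℕ.⌈ n /2⌉                  ≤⟨ ℕ.*-monoʳ-≤ 2 (n≤2^⌈log2⌉n (suc ℕ.⌈ n /2⌉) (rs (ℕ.⌈n/2⌉<n n))) ⟩
  2 ℕ.* 2 ℕ.^ ⌈log2⌉ (suc ℕ.⌈ n /2⌉) _ ∎
  where
  open ℕ.≤-Reasoning

n≤2^⌈log₂n⌉ : ∀ n → n ℕ.≤ 2 ℕ.^ ⌈log₂ n ⌉
n≤2^⌈log₂n⌉ n = n≤2^⌈log2⌉n n (<-wellFounded n)

fromℕ : ℕ → ℚ
fromℕ n = fromℤ (+ n)

fromℕ-homo-+ : ∀ m n → fromℕ (m ℕ.+ n) ≡ fromℕ m + fromℕ n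
fromℕ-homo-+ m n = begin
  fromℕ (m ℕ.+ n)   ≡⟨ ↥p/↧p≡p (fromℕ (m ℕ.+ n)) ⟨
  (+ m ℤ.+ + n) / 1 ≡⟨ cong₂ (λ i j → (i ℤ.+ j) / 1) (ℤ.*-identityʳ (+ m)) (ℤ.*-identityʳ (+ n)) ⟨
  fromℕ m + fromℕ n ∎
  where
  open ≡-Reasoning

fromℕ-mono-≤ : ∀ {m n} → m ℕ.≤ n → fromℕ m ≤ fromℕ n
fromℕ-mono-≤ m≤n = *≤* (ℤ.*-monoʳ-≤-nonNeg (+ 1) (ℤ.+≤+ m≤n))

fromℕ-2^ : ∀ n → fromℕ (2 ℕ.^ n) ≡ (1ℚ + 1ℚ) ^ n
fromℕ-2^ zero    = refl
fromℕ-2^ (suc n) = begin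
  fromℕ (2 ℕ.^ n ℕ.+ (2 ℕ.^ n ℕ.+ 0))     ≡⟨ cong (λ x → fromℕ (2 ℕ.^ n ℕ.+ x)) (ℕ.+-identityʳ _) ⟩
  fromℕ (2 ℕ.^ n ℕ.+ 2 ℕ.^ n)             ≡⟨ fromℕ-homo-+ (2 ℕ.^ n) (2 ℕ.^ n) ⟩
  fromℕ (2 ℕ.^ n) + fromℕ (2 ℕ.^ n)       ≡⟨ cong (λ x → x + x) (fromℕ-2^ n) ⟩
  (1ℚ + 1ℚ) ^ n + (1ℚ + 1ℚ) ^ n           ≡⟨ solve 1 (λ x → x :+ x := (con 1ℚ :+ con 1ℚ) :* x) refl ((1ℚ + 1ℚ) ^ n) ⟩
  (1ℚ + 1ℚ) * (1ℚ + 1ℚ) ^ n               ∎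
  where
  open ≡-Reasoning
  open +-*-Solver

floor[p]*↧p≤↥p : ∀ p → floor p ℤ.* ↧ p ℤ.≤ ↥ p
floor[p]*↧p≤↥p p@record{} = ℤ.[n/d]*d≤n (↥ p) (↧ p)

p≤ceiling : ∀ p → p ≤ fromℤ (ceiling p)
p≤ceiling p@record{} = *≤* (begin
  ↥ p ℤ.* + 1                     ≡⟨ ℤ.*-identityʳ (↥ p) ⟩
  ↥ p                             ≡⟨ ℤ.neg-involutive (↥ p) ⟨
  ℤ.- (ℤ.- ↥ p)                   ≡⟨ cong ℤ.-_ (↥-neg p) ⟨
  ℤ.- (↥ (- p))                   ≤⟨ ℤ.neg-mono-≤ (floor[p]*↧p≤↥p (- p)) ⟩
  ℤ.- (floor (- p) ℤ.* ↧ (- p))   ≡⟨ ℤ.neg-distribˡ-* (floor (- p)) (↧ (- p)) ⟩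
  ceiling p ℤ.* ↧ (- p)           ≡⟨ cong (ceiling p ℤ.*_) (↧-neg p) ⟩
  ceiling p ℤ.* ↧ p               ∎)
  where
  open ℤ.≤-Reasoning

fromℤ≤fromℕ∣∣ : ∀ i → fromℤ i ≤ fromℕ ℤ.∣ i ∣
fromℤ≤fromℕ∣∣ i = *≤* (ℤ.*-monoʳ-≤-nonNeg (+ 1) (i≤∣i∣ i))
  where
  i≤∣i∣ : ∀ i → i ℤ.≤ + ℤ.∣ i ∣
  i≤∣i∣ (+ n)    = ℤ.≤-refl
  i≤∣i∣ -[1+ n ] = ℤ.-≤+

1≤p*∣⌈1/p⌉∣ : ∀ p .{{_ : Positive p}} →
  1ℚ ≤ p * fromℕ ℤ.∣ ceiling ((1/ p) {{pos⇒nonZero p}}) ∣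
1≤p*∣⌈1/p⌉∣ p = begin
  1ℚ                          ≡⟨ *-inverseʳ p {{pos⇒nonZero p}} ⟨
  p * 1/p                     ≤⟨ *-monoˡ-≤-nonNeg p {{pos⇒nonNeg p}} (≤-trans (p≤ceiling 1/p) (fromℤ≤fromℕ∣∣ (ceiling 1/p))) ⟩
  p * fromℕ ℤ.∣ ceiling 1/p ∣ ∎
  where
  open ≤-Reasoning
  1/p : ℚ
  1/p = (1/ p) {{pos⇒nonZero p}}

1≤p*2^⌈log₂p⁻¹⌉ : ∀ p .{{_ : Positive p}} → 1ℚ ≤ p * (1ℚ + 1ℚ) ^ ⌈log₂ p ⁻¹⌉
1≤p*2^⌈log₂p⁻¹⌉ p = begin
  1ℚ                                 ≤⟨ 1≤p*∣⌈1/p⌉∣ p ⟩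
  p * fromℕ m                        ≤⟨ *-monoˡ-≤-nonNeg p {{pos⇒nonNeg p}} (fromℕ-mono-≤ (n≤2^⌈log₂n⌉ m)) ⟩
  p * fromℕ (2 ℕ.^ ⌈log₂ p ⁻¹⌉)      ≡⟨ cong (p *_) (fromℕ-2^ ⌈log₂ p ⁻¹⌉) ⟩
  p * (1ℚ + 1ℚ) ^ ⌈log₂ p ⁻¹⌉        ∎
  where
  open ≤-Reasoning
  m : ℕ
  m = ℤ.∣ ceiling ((1/ p) {{pos⇒nonZero p}}) ∣

^-nonNeg : ∀ p .{{_ : NonNegative p}} n → NonNegative (p ^ n)
^-nonNeg p zero    = _
^-nonNeg p (suc n) = nonNeg*nonNeg⇒nonNeg p (p ^ n) {{^-nonNeg p n}}

∣p^n∣≡∣p∣^n : ∀ p n → ∣ p ^ n ∣ ≡ ∣ p ∣ ^ n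
∣p^n∣≡∣p∣^n p zero    = refl
∣p^n∣≡∣p∣^n p (suc n) = trans (∣p*q∣≡∣p∣*∣q∣ p (p ^ n)) (cong (∣ p ∣ *_) (∣p^n∣≡∣p∣^n p n))

^≤1 : ∀ p .{{_ : NonNegative p}} → p ≤ 1ℚ → ∀ n → p ^ n ≤ 1ℚ
^≤1 p p≤1 zero    = ≤-refl
^≤1 p p≤1 (suc n) = begin
  p * p ^ n  ≤⟨ *-monoʳ-≤-nonNeg (p ^ n) {{^-nonNeg p n}} p≤1 ⟩
  1ℚ * p ^ n ≡⟨ *-identityˡ (p ^ n) ⟩
  p ^ n      ≤⟨ ^≤1 p p≤1 n ⟩
  1ℚ         ∎
  where
  open ≤-Reasoning

p≤p+q : ∀ p q .{{_ : NonNegative q}} → p ≤ p + q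
p≤p+q p q = begin
  p      ≡⟨ +-identityʳ p ⟨
  p + 0ℚ ≤⟨ +-monoʳ-≤ p (nonNegative⁻¹ q) ⟩
  p + q  ∎
  where
  open ≤-Reasoning

-- Bernoulli's inequality for 1/a, cleared of denominators, with b = 1 − a.
bernoulli : ∀ a b .{{_ : NonNegative a}} .{{_ : NonNegative b}} → a + b ≡ 1ℚ →
  ∀ n → a ^ n * (1ℚ + b * fromℕ n) ≤ 1ℚ
bernoulli a b a+b≡1 zero    = ≤-reflexive (solve 1 (λ x → con 1ℚ :* (con 1ℚ :+ x :* con 0ℚ) := con 1ℚ) refl b)
  where
  open +-*-Solver
bernoulli a b a+b≡1 (suc n) = begin
  a * a ^ n * (1ℚ + b * fromℕ (suc n))           ≡⟨ cong (λ x → a * a ^ n * (1ℚ + b * x)) (fromℕ-homo-+ 1 n) ⟩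
  a * a ^ n * (1ℚ + b * (1ℚ + fromℕ n))          ≤⟨ p≤p+q _ _ {{sq}} ⟩
  a * a ^ n * (1ℚ + b * (1ℚ + fromℕ n)) + a ^ n * (b * b * (1ℚ + fromℕ n))
    ≡⟨ solve 4 (λ a b c n →
         a :* c :* (con 1ℚ :+ b :* (con 1ℚ :+ n)) :+ c :* (b :* b :* (con 1ℚ :+ n))
         := c :* (a :+ (a :+ b) :* (b :* (con 1ℚ :+ n)))) refl a b (a ^ n) (fromℕ n) ⟩
  a ^ n * (a + (a + b) * (b * (1ℚ + fromℕ n)))
    ≡⟨ cong (λ x → a ^ n * (a + x * (b * (1ℚ + fromℕ n)))) a+b≡1 ⟩
  a ^ n * (a + 1ℚ * (b * (1ℚ + fromℕ n)))
    ≡⟨ cong (a ^ n *_) (solve 3 (λ a b n → a :+ con 1ℚ :* (b :* (con 1ℚ :+ n)) := (a :+ b) :+ b :* n) refl a b (fromℕ n)) ⟩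
  a ^ n * (a + b + b * fromℕ n)                  ≡⟨ cong (λ x → a ^ n * (x + b * fromℕ n)) a+b≡1 ⟩
  a ^ n * (1ℚ + b * fromℕ n)                     ≤⟨ bernoulli a b a+b≡1 n ⟩
  1ℚ                                             ∎
  where
  open ≤-Reasoning
  open +-*-Solver
  sq : NonNegative (a ^ n * (b * b * (1ℚ + fromℕ n)))
  sq = nonNeg*nonNeg⇒nonNeg (a ^ n) {{^-nonNeg a n}} _
         {{nonNeg*nonNeg⇒nonNeg (b * b) {{nonNeg*nonNeg⇒nonNeg b b}} (1ℚ + fromℕ n)
           {{nonNeg+nonNeg⇒nonNeg 1ℚ (fromℕ n)}}}}

∃[n]a^n*2≤1 : ∀ a .{{_ : NonNegative a}} → a < 1ℚ → ∃ λ n → a ^ n * (1ℚ + 1ℚ) ≤ 1ℚ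
∃[n]a^n*2≤1 a a<1 = n , (begin
  a ^ n * (1ℚ + 1ℚ)          ≤⟨ *-monoˡ-≤-nonNeg (a ^ n) {{^-nonNeg a n}} (+-monoʳ-≤ 1ℚ (1≤p*∣⌈1/p⌉∣ b)) ⟩
  a ^ n * (1ℚ + b * fromℕ n) ≤⟨ bernoulli a b {{it}} {{pos⇒nonNeg b}} a+b≡1 n ⟩
  1ℚ                         ∎)
  where
  open ≤-Reasoning
  open +-*-Solver
  b : ℚ
  b = 1ℚ - a
  a+b≡1 : a + b ≡ 1ℚ
  a+b≡1 = solve 1 (λ a → a :+ (con 1ℚ :- a) := con 1ℚ) refl a
  instance
    b>0 : Positive b
    b>0 = positive (subst (_< b) (+-inverseʳ a) (+-monoˡ-< (- a) a<1))
  n : ℕ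
  n = ℤ.∣ ceiling ((1/ b) {{pos⇒nonZero b}}) ∣

a^nL≤ρ : ∀ a .{{_ : NonNegative a}} n → a ^ n * (1ℚ + 1ℚ) ≤ 1ℚ →
  ∀ ρ .{{_ : Positive ρ}} → a ^ (n ℕ.* ⌈log₂ ρ ⁻¹⌉) ≤ ρ
a^nL≤ρ a n a^n*2≤1 ρ = *-cancelʳ-≤-pos (2ℚ ^ L) {{2^L>0 L}} (begin
  a ^ (n ℕ.* L) * 2ℚ ^ L ≡⟨ cong (_* 2ℚ ^ L) (^-assocʳ a n L) ⟨
  (a ^ n) ^ L * 2ℚ ^ L   ≡⟨ ^-distrib-* (a ^ n) 2ℚ L ⟨
  (a ^ n * 2ℚ) ^ L       ≤⟨ ^≤1 (a ^ n * 2ℚ) {{nonNeg*nonNeg⇒nonNeg (a ^ n) {{^-nonNeg a n}} 2ℚ}} a^n*2≤1 L ⟩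
  1ℚ                     ≤⟨ 1≤p*2^⌈log₂p⁻¹⌉ ρ ⟩
  ρ * 2ℚ ^ L             ∎)
  where
  open ≤-Reasoning
  L : ℕ
  L = ⌈log₂ ρ ⁻¹⌉
  2ℚ : ℚ
  2ℚ = 1ℚ + 1ℚ
  2^L>0 : ∀ L → Positive (2ℚ ^ L)
  2^L>0 zero    = _
  2^L>0 (suc L) = pos*pos⇒pos 2ℚ (2ℚ ^ L) {{2^L>0 L}}

-1<p<1⇒∣p∣<1 : ∀ {p} → - 1ℚ < p → p < 1ℚ → ∣ p ∣ < 1ℚ
-1<p<1⇒∣p∣<1 {p} -1<p p<1 with ∣p∣≡p∨∣p∣≡-p p
... | inj₁ ∣p∣≡p  = subst (_< 1ℚ) (sym ∣p∣≡p) p<1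
... | inj₂ ∣p∣≡-p = subst (_< 1ℚ) (sym ∣p∣≡-p) (neg-antimono-< -1<p)

succ : ∀ {n} → Fin (suc n) → Fin (suc n)
succ i with view i
... | ‵fromℕ     = zero
... | ‵inject₁ j = suc j

pred : ∀ {n} → Fin (suc n) → Fin (suc n)
pred zero    = Fin.fromℕ _
pred (suc i) = inject₁ i

succ-inject₁ : ∀ {n} (i : Fin n) → succ (inject₁ i) ≡ suc i
succ-inject₁ i rewrite view-inject₁ i = refl

succ-pred : ∀ {n} (i : Fin (suc n)) → succ (pred i) ≡ i
succ-pred {n} zero rewrite view-fromℕ n = refl
succ-pred (suc i)  = succ-inject₁ i

pred-succ : ∀ {n} (i : Fin (suc n)) → pred (succ i) ≡ i
pred-succ i with view i
... | ‵fromℕ     = refl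
... | ‵inject₁ j = refl

connected-⊥⇒≡ : ∀ {m k} {ends : Fin m → Fin k × Fin k} {u v} → Connected ends ⊥ u v → u ≡ v
connected-⊥⇒≡ = EqC.gfold isEquivalence (λ u → u) λ { (e , e∈⊥ , _) → contradiction e∈⊥ ∉⊥ }

module _ (n : ℕ) where

  bond : Graph
  bond = record { #V = 2 ; #E = suc n ; ends = const (zero , suc zero) }

  private
    D : Set
    D = Dart bond

  -- The edges are in opposite cyclic orders around the two ends.
  rotate unrotate : D → D
  rotate   (e , false) = succ e , false
  rotate   (e , true)  = pred e , true
  unrotate (e , false) = pred e , false
  unrotate (e , true)  = succ e , true

  rotation : D ↔ D
  rotation = mk↔ₛ′ rotate unrotate rotate-unrotate unrotate-rotate
    where
    rotate-unrotate : ∀ d → rotate (unrotate d) ≡ d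
    rotate-unrotate (e , false) = cong (_, false) (succ-pred e)
    rotate-unrotate (e , true)  = cong (_, true) (pred-succ e)
    unrotate-rotate : ∀ d → unrotate (rotate d) ≡ d
    unrotate-rotate (e , false) = cong (_, false) (pred-succ e)
    unrotate-rotate (e , true)  = cong (_, true) (succ-pred e)

  private
    _~_ : D → D → Set
    _~_ = SameOrbit bond rotate

    trans~ : ∀ {c d e} → c ~ d → d ~ e → c ~ e
    trans~ = EqC.transitive _

    sym~ : ∀ {c d} → c ~ d → d ~ c
    sym~ = EqC.symmetric _

  rotate-transitive : ∀ b e → (zero , b) ~ (e , b)
  rotate-transitive b = <-weakInduction (λ e → (zero , b) ~ (e , b)) ε λ e p → trans~ p (step b e)
    where
    step : ∀ b (e : Fin n) → (inject₁ e , b) ~ (suc e , b)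
    step false e = EqC.return (cong (_, false) (succ-inject₁ e))
    step true  e = sym~ (EqC.return refl)

  tail-rotate : ∀ d → tail bond (rotate d) ≡ tail bond d
  tail-rotate (e , false) = refl
  tail-rotate (e , true)  = refl

  rotate-orbits-tail : ∀ {d d′} → d ~ d′ → tail bond d ≡ tail bond d′
  rotate-orbits-tail = EqC.gfold isEquivalence (tail bond) λ { {d} refl → sym (tail-rotate d) }

  rotate-tail-orbits : ∀ d d′ → tail bond d ≡ tail bond d′ → d ~ d′
  rotate-tail-orbits (e , false) (e′ , false) _ = trans~ (sym~ (rotate-transitive false e)) (rotate-transitive false e′)
  rotate-tail-orbits (e , true)  (e′ , true)  _ = trans~ (sym~ (rotate-transitive true e)) (rotate-transitive true e′)

  -- Consecutive edges bound a digon, which is labelled by the later of the two.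
  digon : D → Fin (suc n)
  digon (e , false) = e
  digon (e , true)  = succ e

  digon-next : ∀ d → digon (rotate (reverse bond d)) ≡ digon d
  digon-next (e , false) = succ-pred e
  digon-next (e , true)  = refl

  nonempty-connects : ∀ {A} → Nonempty A → Connected (Graph.ends bond) A zero (suc zero)
  nonempty-connects (e , e∈A) = EqC.return (e , e∈A , refl)

  κ-nonempty : ∀ {A} → Nonempty A → κ bond A ≡ 1
  κ-nonempty {A} A≢∅ = cong List.length (trans
    (filter-accept (leastInComponent? bond A) {zero} λ _ _ → ℕ.z≤n)
    (cong (zero ∷_) (filter-reject (leastInComponent? bond A) {suc zero} ¬least)))
    where
    ¬least : ¬ LeastInComponent bond A (suc zero)
    ¬least least with () ← least zero (nonempty-connects A≢∅)

  κ-⊥ : κ bond ⊥ ≡ 2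
  κ-⊥ = cong List.length (filter-all (leastInComponent? bond ⊥) (least ∷ least ∷ []))
    where
    least : ∀ {v} → LeastInComponent bond ⊥ v
    least u v~u with refl ← connected-⊥⇒≡ {ends = Graph.ends bond} v~u = ℕ.≤-refl

  #isolated-bond : #isolated bond ≡ 0
  #isolated-bond = cong List.length (filter-none (isolated? bond)
    ((λ iso → proj₁ (iso zero) refl) ∷ (λ iso → proj₂ (iso zero) refl) ∷ []))

  bond-embedding : PlanarEmbedding bond
  bond-embedding = record
    { rotation        = rotation
    ; rotation-orbits = λ d d′ → mk⇔ (rotate-tail-orbits d d′) rotate-orbits-tail
    ; #walks          = suc n
    ; walks           = record
      { to        = digon
      ; from      = _, false
      ; to-cong   = EqC.gfold isEquivalence digon λ { {d} refl → sym (digon-next d) }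
      ; from-cong = λ { refl → ε }
      ; inverse   = digon-orbit , orbit-digon
      }
    ; euler = begin
        2 ℕ.+ (suc n ℕ.+ #isolated bond) ≡⟨ cong (λ x → 2 ℕ.+ (suc n ℕ.+ x)) #isolated-bond ⟩
        2 ℕ.+ (suc n ℕ.+ 0)              ≡⟨ cong (2 ℕ.+_) (ℕ.+-identityʳ (suc n)) ⟩
        2 ℕ.+ suc n                      ≡⟨ ℕ.+-comm 2 (suc n) ⟩
        suc n ℕ.+ 2                      ≡⟨ cong (λ x → suc n ℕ.+ 2 ℕ.* x) (κ-nonempty {⊤} (zero , ∈⊤)) ⟨
        suc n ℕ.+ 2 ℕ.* κ bond ⊤         ∎
    }
    where
    open ≡-Reasoning
    next : D → D
    next d = rotate (reverse bond d)
    digon-orbit : ∀ {e d} → SameOrbit bond next d (e , false) → digon d ≡ e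
    digon-orbit = EqC.gfold isEquivalence digon λ { {d} refl → sym (digon-next d) }
    orbit-digon : ∀ {d e} → e ≡ digon d → SameOrbit bond next (e , false) d
    orbit-digon {e , false} refl = ε
    orbit-digon {e , true}  refl = EqC.symmetric _ (EqC.return refl)

  twoTerminalBond : PlanarTwoTerminalGraph
  twoTerminalBond = record
    { graph     = bond
    ; s         = zero
    ; t         = suc zero
    ; s≢t       = λ ()
    ; embedding = bond-embedding
    ; outer     = inj₁ ((zero , false) , (pred zero , true) , refl , refl , EqC.return refl)
    }

subsets-⊥∷nonempty : ∀ m → ∃ λ As → subsets m ≡ ⊥ ∷ As × All Nonempty As
subsets-⊥∷nonempty zero    = [] , refl , []
subsets-⊥∷nonempty (suc m) with As , eq , ne ← subsets-⊥∷nonempty m =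
  List.map (outside Vec.∷_) As ++ List.map (inside Vec.∷_) (subsets m) ,
  cong (λ Bs → List.map (outside Vec.∷_) Bs ++ List.map (inside Vec.∷_) (subsets m)) eq ,
  ++⁺ (map⁺ (All.map (Product.map suc Vec.there) ne))
      (map⁺ (All.universal (λ _ → zero , Vec.here) (subsets m)))

sumℚ-++ : ∀ xs ys → sumℚ (xs ++ ys) ≡ sumℚ xs + sumℚ ys
sumℚ-++ []       ys = sym (+-identityˡ (sumℚ ys))
sumℚ-++ (x ∷ xs) ys = trans (cong (λ y → x + y) (sumℚ-++ xs ys)) (sym (+-assoc x (sumℚ xs) (sumℚ ys)))

sumℚ-*ˡ : ∀ {A : Set} w {f g : A → ℚ} {xs} → All (λ x → f x ≡ w * g x) xs →
  sumℚ (List.map f xs) ≡ w * sumℚ (List.map g xs)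
sumℚ-*ˡ w []                 = sym (*-zeroʳ w)
sumℚ-*ˡ w {g = g} {x ∷ xs} (eq ∷ eqs) = trans (cong₂ _+_ eq (sumℚ-*ˡ w eqs)) (sym (*-distribˡ-+ w (g x) _))

weight : ∀ {m} → ℚ → Subset m → ℚ
weight w A = product (λ e → if does (e ∈? A) then w else 1ℚ)

weight-⊥ : ∀ w m → weight w (⊥ {m}) ≡ 1ℚ
weight-⊥ w zero    = refl
weight-⊥ w (suc m) = trans (*-identityˡ _) (weight-⊥ w m)

sum-weight : ∀ w m → sumℚ (List.map (weight w) (subsets m)) ≡ (1ℚ + w) ^ m
sum-weight w zero    = refl
sum-weight w (suc m) = begin
  sumℚ (List.map (weight w) (outs ++ ins))
    ≡⟨ cong sumℚ (map-++ (weight w) outs ins) ⟩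
  sumℚ (List.map (weight w) outs ++ List.map (weight w) ins)
    ≡⟨ sumℚ-++ (List.map (weight w) outs) _ ⟩
  sumℚ (List.map (weight w) outs) + sumℚ (List.map (weight w) ins)
    ≡⟨ cong₂ (λ xs ys → sumℚ xs + sumℚ ys) (map-∘ (subsets m)) (map-∘ (subsets m)) ⟨
  sumℚ (List.map (weight w ∘ (outside Vec.∷_)) (subsets m)) + sumℚ (List.map (weight w ∘ (inside Vec.∷_)) (subsets m))
    ≡⟨ cong₂ _+_ (sumℚ-*ˡ 1ℚ (All.universal (λ _ → refl) (subsets m)))
                 (sumℚ-*ˡ w (All.universal (λ _ → refl) (subsets m))) ⟩
  1ℚ * sumℚ (List.map (weight w) (subsets m)) + w * sumℚ (List.map (weight w) (subsets m))
    ≡⟨ *-distribʳ-+ _ 1ℚ w ⟨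
  (1ℚ + w) * sumℚ (List.map (weight w) (subsets m))
    ≡⟨ cong ((1ℚ + w) *_) (sum-weight w m) ⟩
  (1ℚ + w) * (1ℚ + w) ^ m ∎
  where
  open ≡-Reasoning
  outs = List.map (outside Vec.∷_) (subsets m)
  ins  = List.map (inside Vec.∷_) (subsets m)

module _ (q w : ℚ) (n : ℕ) where
  private
    Υ = twoTerminalBond n
    As = proj₁ (subsets-⊥∷nonempty (suc n))
    subsets≡ = proj₁ (proj₂ (subsets-⊥∷nonempty (suc n)))
    nonempty = proj₂ (proj₂ (subsets-⊥∷nonempty (suc n)))
    f = term q Υ (const w)
    C? = λ A → connected? (Graph.ends (bond n)) A zero (suc zero)
    ⊥-separates : ¬ Connected (Graph.ends (bond n)) ⊥ zero (suc zero)
    ⊥-separates c with () ← connected-⊥⇒≡ {ends = Graph.ends (bond n)} c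

  Zₛ|ₜ-bond : Zₛ|ₜ q Υ (const w) ≡ q * q
  Zₛ|ₜ-bond = begin
    sumℚ (List.map f (filter (¬? ∘ C?) (subsets (suc n))))
      ≡⟨ cong (sumℚ ∘ List.map f ∘ filter (¬? ∘ C?)) subsets≡ ⟩
    sumℚ (List.map f (filter (¬? ∘ C?) (⊥ ∷ As)))
      ≡⟨ cong (sumℚ ∘ List.map f) (filter-accept (¬? ∘ C?) {xs = As} ⊥-separates) ⟩
    sumℚ (List.map f (⊥ ∷ filter (¬? ∘ C?) As))
      ≡⟨ cong (λ Bs → sumℚ (List.map f (⊥ ∷ Bs)))
           (filter-none (¬? ∘ C?) (All.map (λ ne ¬c → ¬c (nonempty-connects n ne)) nonempty)) ⟩
    weight w (⊥ {suc n}) * q ^ κ (bond n) ⊥ + 0ℚ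
      ≡⟨ cong₂ (λ x k → x * q ^ k + 0ℚ) (weight-⊥ w (suc n)) (κ-⊥ n) ⟩
    1ℚ * (q * (q * 1ℚ)) + 0ℚ
      ≡⟨ solve 1 (λ q → con 1ℚ :* (q :* (q :* con 1ℚ)) :+ con 0ℚ := q :* q) refl q ⟩
    q * q ∎
    where
    open ≡-Reasoning
    open +-*-Solver

  Zₛₜ-bond : Zₛₜ q Υ (const w) ≡ q * ((1ℚ + w) ^ suc n - 1ℚ)
  Zₛₜ-bond = begin
    sumℚ (List.map f (filter C? (subsets (suc n))))
      ≡⟨ cong (sumℚ ∘ List.map f ∘ filter C?) subsets≡ ⟩
    sumℚ (List.map f (filter C? (⊥ ∷ As)))
      ≡⟨ cong (sumℚ ∘ List.map f) (filter-reject C? {xs = As} ⊥-separates) ⟩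
    sumℚ (List.map f (filter C? As))
      ≡⟨ cong (sumℚ ∘ List.map f) (filter-all C? (All.map (nonempty-connects n) nonempty)) ⟩
    sumℚ (List.map f As)
      ≡⟨ sumℚ-*ˡ q (All.map term-nonempty nonempty) ⟩
    q * S
      ≡⟨ cong (q *_) (solve 1 (λ s → s := (con 1ℚ :+ s) :- con 1ℚ) refl S) ⟩
    q * (1ℚ + S - 1ℚ)
      ≡⟨ cong (λ x → q * (x + S - 1ℚ)) (weight-⊥ w (suc n)) ⟨
    q * (sumℚ (List.map (weight w) (⊥ ∷ As)) - 1ℚ)
      ≡⟨ cong (λ Bs → q * (sumℚ (List.map (weight w) Bs) - 1ℚ)) subsets≡ ⟨
    q * (sumℚ (List.map (weight w) (subsets (suc n))) - 1ℚ)
      ≡⟨ cong (λ x → q * (x - 1ℚ)) (sum-weight w (suc n)) ⟩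
    q * ((1ℚ + w) ^ suc n - 1ℚ) ∎
    where
    open ≡-Reasoning
    open +-*-Solver
    S = sumℚ (List.map (weight w) As)
    term-nonempty : ∀ {A} → Nonempty A → f A ≡ q * weight w A
    term-nonempty {A} ne = begin
      weight w A * q ^ κ (bond n) A ≡⟨ cong (λ k → weight w A * q ^ k) (κ-nonempty n ne) ⟩
      weight w A * (q * 1ℚ)         ≡⟨ cong (weight w A *_) (*-identityʳ q) ⟩
      weight w A * q                ≡⟨ *-comm (weight w A) q ⟩
      q * weight w A                ∎

  bond-implements : q ≢ 0ℚ → Implements q Υ (const w) ((1ℚ + w) ^ suc n - 1ℚ)
  bond-implements q≢0 = Z≢0 , (begin
    β                           ≡⟨ *-identityʳ β ⟨
    β * 1ℚ                      ≡⟨ cong (β *_) (*-inverseʳ Z) ⟨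
    β * (Z * 1/ Z)              ≡⟨ *-assoc β Z (1/ Z) ⟨
    β * Z * 1/ Z                ≡⟨ cong (_* 1/ Z) βZ ⟩
    q * Zₛₜ q Υ (const w) * 1/ Z ∎)
    where
    open ≡-Reasoning
    open +-*-Solver
    β = (1ℚ + w) ^ suc n - 1ℚ
    Z = Zₛ|ₜ q Υ (const w)
    Z≢0 : Z ≢ 0ℚ
    Z≢0 Z≡0 = q≢0 (begin
      q              ≡⟨ *-identityʳ q ⟨
      q * 1ℚ         ≡⟨ cong (q *_) (*-inverseʳ q) ⟨
      q * (q * 1/ q) ≡⟨ *-assoc q q (1/ q) ⟨
      q * q * 1/ q   ≡⟨ cong (_* 1/ q) (trans (sym Zₛ|ₜ-bond) Z≡0) ⟩
      0ℚ * 1/ q      ≡⟨ *-zeroˡ (1/ q) ⟩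
      0ℚ             ∎)
      where instance _ = ≢-nonZero q≢0
    instance _ = ≢-nonZero Z≢0
    βZ : β * Z ≡ q * Zₛₜ q Υ (const w)
    βZ = begin
      β * Z                  ≡⟨ cong (β *_) Zₛ|ₜ-bond ⟩
      β * (q * q)            ≡⟨ solve 2 (λ b q → b :* (q :* q) := q :* (q :* b)) refl β q ⟩
      q * (q * β)            ≡⟨ cong (q *_) Zₛₜ-bond ⟨
      q * Zₛₜ q Υ (const w)  ∎

lemma3 : (q α₂ : ℚ) →
    ¬ (0ℚ ≤ q × q ≤ + 5 / 1) →
    -[1+ 1 ] / 1 < α₂ → α₂ < 0ℚ →
    Σ[ p ∈ Polynomial ] Σ[ ρ₀ ∈ ℚ ] 0ℚ < ρ₀ ×
    ((ρ : ℚ) .{{_ : Positive ρ}} → ρ ≤ ρ₀ →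
    Σ[ Υ ∈ PlanarTwoTerminalGraph ]
    Σ[ ŵ ∈ (Fin (PlanarTwoTerminalGraph.#E Υ) → ℚ) ]
    Σ[ β ∈ ℚ ]
    (∀ e → ŵ e ≡ α₂) ×
    Implements q Υ ŵ β ×
    ∣ 1ℚ + β ∣ ≤ ρ ×
    size Υ ℕ.≤ eval p ⌈log₂ ρ ⁻¹⌉)
lemma3 q α₂ q∉[0,5] -2<α₂ α₂<0 =
  (3 ∷ N ∷ []) , 1ℚ , positive⁻¹ 1ℚ , λ ρ _ →
    let L = ⌈log₂ ρ ⁻¹⌉ in
    twoTerminalBond (N ℕ.* L) , const α₂ , y ^ suc (N ℕ.* L) - 1ℚ ,
    (λ _ → refl) ,
    bond-implements q α₂ (N ℕ.* L) q≢0 ,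
    near-zero ρ ,
    ℕ.≤-reflexive (cong (3 ℕ.+_) (size≡ L))
  where
  y : ℚ
  y = 1ℚ + α₂

  ∣y∣<1 : ∣ y ∣ < 1ℚ
  ∣y∣<1 = -1<p<1⇒∣p∣<1 (+-monoʳ-< 1ℚ -2<α₂) (+-monoʳ-< 1ℚ α₂<0)

  instance
    ∣y∣≥0 : NonNegative ∣ y ∣
    ∣y∣≥0 = ∣-∣-nonNeg y

  N : ℕ
  N = proj₁ (∃[n]a^n*2≤1 ∣ y ∣ ∣y∣<1)

  q≢0 : q ≢ 0ℚ
  q≢0 refl = q∉[0,5] (≤-refl , nonNegative⁻¹ (+ 5 / 1))

  near-zero : ∀ ρ .{{_ : Positive ρ}} → ∣ 1ℚ + (y ^ suc (N ℕ.* ⌈log₂ ρ ⁻¹⌉) - 1ℚ) ∣ ≤ ρ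
  near-zero ρ = begin
    ∣ 1ℚ + (y ^ suc k - 1ℚ) ∣ ≡⟨ cong ∣_∣ (solve 1 (λ x → con 1ℚ :+ (x :- con 1ℚ) := x) refl (y ^ suc k)) ⟩
    ∣ y ^ suc k ∣             ≡⟨ ∣p^n∣≡∣p∣^n y (suc k) ⟩
    ∣ y ∣ * ∣ y ∣ ^ k         ≤⟨ *-monoʳ-≤-nonNeg (∣ y ∣ ^ k) {{^-nonNeg ∣ y ∣ k}} (<⇒≤ ∣y∣<1) ⟩
    1ℚ * ∣ y ∣ ^ k            ≡⟨ *-identityˡ (∣ y ∣ ^ k) ⟩
    ∣ y ∣ ^ k                 ≤⟨ a^nL≤ρ ∣ y ∣ N (proj₂ (∃[n]a^n*2≤1 ∣ y ∣ ∣y∣<1)) ρ ⟩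
    ρ                         ∎
    where
    open ≤-Reasoning
    open +-*-Solver
    k : ℕ
    k = N ℕ.* ⌈log₂ ρ ⁻¹⌉

  size≡ : ∀ L → N ℕ.* L ≡ L ℕ.* (N ℕ.+ L ℕ.* 0)
  size≡ L = begin
    N ℕ.* L               ≡⟨ ℕ.*-comm N L ⟩
    L ℕ.* N               ≡⟨ cong (L ℕ.*_) (ℕ.+-identityʳ N) ⟨
    L ℕ.* (N ℕ.+ 0)       ≡⟨ cong (λ x → L ℕ.* (N ℕ.+ x)) (ℕ.*-zeroʳ L) ⟨
    L ℕ.* (N ℕ.+ L ℕ.* 0) ∎
    where
    open ≡-Reasoning
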